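{- There is an absolute constant $C$ such that the following holds. Let $e_1,\dots,e_k\in\mathbb{C}^{n\times n}$ be an anticommuting family with $e_1^2,\dots,e_k^2\neq 0$. Then $k\le Cn$.
   Context: A family $e_1,\dots,e_k$ of complex $n\times n$ matrices is called anticommuting if $e_ie_j=-e_je_i$ for all distinct $i,j\in\{1,\dots,k\}$. -}

module Defs where

open import Algebra.Bundles using (CommutativeRing)
open import Algebra.Bundles.Raw using (RawRing)
import Algebra.Definitions.RawMonoid as RawMonoidDefinitions
import Algebra.Properties.CommutativeSemigroup as CommutativeSemigroupProperties
open import Data.Fin.Base using (Fin)
open import Data.Nat.Base as ℕ using (ℕ)
import Data.Nat.Properties as ℕ
open import Data.Product.Base using (∃; _×_; _,_)
open import Data.Rational.Base
open import Data.Rational.Properties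
open import Data.Vec.Functional using (Vector)
open import Level using (0ℓ)
open import Relation.Binary.PropositionalEquality

-- ℝ is the setoid of Cauchy sequences of rationals; _≈ʳ_ is equality of limits.

Cauchy : (ℕ → ℚ) → Set
Cauchy x = ∀ ε → 0ℚ < ε →
  ∃ λ N → ∀ m n → N ℕ.≤ m → N ℕ.≤ n → ∣ x m - x n ∣ < ε

record ℝ : Set where
  constructor mkℝ
  field
    seq    : ℕ → ℚ
    cauchy : Cauchy seq

open ℝ public

infix 4 _≈ʳ_
_≈ʳ_ : ℝ → ℝ → Set
x ≈ʳ y = ∀ ε → 0ℚ < ε → ∃ λ N → ∀ n → N ℕ.≤ n → ∣ seq x n - seq y n ∣ < ε

sum-difference : ∀ a b c d → (a + b) - (c + d) ≡ (a - c) + (b - d)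
sum-difference a b c d =
  trans (cong ((a + b) +_) (neg-distrib-+ c d)) (interchange a b (- c) (- d))
  where open CommutativeSemigroupProperties
               (CommutativeRing.+-commutativeSemigroup +-*-commutativeRing) using (interchange)

p-q+q≡p : ∀ p q → (p - q) + q ≡ p
p-q+q≡p p q = trans (+-assoc p (- q) q) (trans (cong (p +_) (+-inverseˡ q)) (+-identityʳ p))

*-distribˡ-- : ∀ p q r → p * (q - r) ≡ p * q - p * r
*-distribˡ-- p q r = trans (*-distribˡ-+ p q (- r)) (cong (p * q +_) (sym (neg-distribʳ-* p r)))

product-difference : ∀ a b c d → a * b - c * d ≡ a * (b - d) + d * (a - c)
product-difference a b c d = sym (begin
  a * (b - d) + d * (a - c)              ≡⟨ cong₂ _+_ (*-distribˡ-- a b d) (*-distribˡ-- d a c) ⟩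
  (a * b - a * d) + (d * a - d * c)      ≡⟨ cong₂ (λ u v → (a * b - a * d) + (u - v)) (*-comm d a) (*-comm d c) ⟩
  (a * b - a * d) + (a * d - c * d)      ≡⟨ sym (+-assoc (a * b - a * d) (a * d) (- (c * d))) ⟩
  ((a * b - a * d) + a * d) - c * d      ≡⟨ cong (_- c * d) (p-q+q≡p (a * b) (a * d)) ⟩
  a * b - c * d                          ∎)
  where open ≡-Reasoning

0<½* : ∀ {ε} → 0ℚ < ε → 0ℚ < ½ * ε
0<½* {ε} 0<ε = *-monoʳ-<-pos ½ 0<ε

½+½ : ∀ ε → ½ * ε + ½ * ε ≡ ε
½+½ ε = trans (sym (*-distribʳ-+ ε ½ ½)) (*-identityˡ ε)

constant-cauchy : ∀ q → Cauchy (λ _ → q)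
constant-cauchy q ε 0<ε = 0 , λ _ _ _ _ → subst (λ r → ∣ r ∣ < ε) (sym (+-inverseʳ q)) 0<ε

+-cauchy : ∀ x y → Cauchy x → Cauchy y → Cauchy (λ n → x n + y n)
+-cauchy x y cx cy ε 0<ε
  with M , hx ← cx (½ * ε) (0<½* 0<ε)
     | N , hy ← cy (½ * ε) (0<½* 0<ε)
  = M ℕ.⊔ N , λ m n ≤m ≤n → begin-strict
    ∣ (x m + y m) - (x n + y n) ∣
      ≡⟨ cong ∣_∣ (sum-difference (x m) (y m) (x n) (y n)) ⟩
    ∣ (x m - x n) + (y m - y n) ∣
      ≤⟨ ∣p+q∣≤∣p∣+∣q∣ (x m - x n) (y m - y n) ⟩
    ∣ x m - x n ∣ + ∣ y m - y n ∣
      <⟨ +-mono-< (hx m n (ℕ.m⊔n≤o⇒m≤o M N ≤m) (ℕ.m⊔n≤o⇒m≤o M N ≤n))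
                  (hy m n (ℕ.m⊔n≤o⇒n≤o M N ≤m) (ℕ.m⊔n≤o⇒n≤o M N ≤n)) ⟩
    ½ * ε + ½ * ε
      ≡⟨ ½+½ ε ⟩
    ε ∎
  where open ≤-Reasoning

neg-cauchy : ∀ x → Cauchy x → Cauchy (λ n → - x n)
neg-cauchy x cx ε 0<ε with N , h ← cx ε 0<ε
  = N , λ m n ≤m ≤n → subst (_< ε)
      (trans (sym (∣-p∣≡∣p∣ (x m - x n))) (cong ∣_∣ (neg-distrib-+ (x m) (- x n))))
      (h m n ≤m ≤n)

eventually-bounded : ∀ {x} → Cauchy x →
  ∃ λ B → 0ℚ < B × ∃ λ N → ∀ n → N ℕ.≤ n → ∣ x n ∣ < B
eventually-bounded {x} cx with N , h ← cx 1ℚ (positive⁻¹ 1ℚ)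
  = 1ℚ + ∣ x N ∣ , +-mono-<-≤ (positive⁻¹ 1ℚ) (0≤∣p∣ (x N)) , N , λ n ≤n → begin-strict
    ∣ x n ∣
      ≡⟨ cong ∣_∣ (sym (p-q+q≡p (x n) (x N))) ⟩
    ∣ (x n - x N) + x N ∣
      ≤⟨ ∣p+q∣≤∣p∣+∣q∣ (x n - x N) (x N) ⟩
    ∣ x n - x N ∣ + ∣ x N ∣
      <⟨ +-monoˡ-< ∣ x N ∣ (h n N ≤n ℕ.≤-refl) ⟩
    1ℚ + ∣ x N ∣ ∎
  where open ≤-Reasoning

shrink : ∀ {B ε} → 0ℚ < B → 0ℚ < ε → ∃ λ δ → 0ℚ < δ × B * δ ≡ ε
shrink {B} {ε} 0<B 0<ε = 1/ B * ε
  , positive⁻¹ (1/ B * ε) {{pos*pos⇒pos (1/ B) {{1/pos⇒pos B}} ε}}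
  , trans (sym (*-assoc B (1/ B) ε)) (trans (cong (_* ε) (*-inverseʳ B)) (*-identityˡ ε))
  where instance
    B-positive : Positive B
    B-positive = positive 0<B
    ε-positive : Positive ε
    ε-positive = positive 0<ε
    B-nonZero : NonZero B
    B-nonZero = pos⇒nonZero B

∣p*q∣<B*δ : ∀ {B δ} p q → 0ℚ < B → ∣ p ∣ < B → ∣ q ∣ < δ → ∣ p * q ∣ < B * δ
∣p*q∣<B*δ {B} {δ} p q 0<B p<B q<δ = begin-strict
  ∣ p * q ∣      ≡⟨ ∣p*q∣≡∣p∣*∣q∣ p q ⟩
  ∣ p ∣ * ∣ q ∣  ≤⟨ *-monoʳ-≤-nonNeg ∣ q ∣ {{∣-∣-nonNeg q}} (<⇒≤ p<B) ⟩
  B * ∣ q ∣      <⟨ *-monoʳ-<-pos B {{positive 0<B}} q<δ ⟩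
  B * δ          ∎
  where open ≤-Reasoning

*-cauchy : ∀ x y → Cauchy x → Cauchy y → Cauchy (λ n → x n * y n)
*-cauchy x y cx cy ε 0<ε
  with A , 0<A , K , bx ← eventually-bounded cx
     | B , 0<B , L , by ← eventually-bounded cy
  with α , 0<α , Aα≡ ← shrink 0<A (0<½* 0<ε)
     | β , 0<β , Bβ≡ ← shrink 0<B (0<½* 0<ε)
  with M , hy ← cy α 0<α
     | N , hx ← cx β 0<β
  = (K ℕ.⊔ L) ℕ.⊔ (M ℕ.⊔ N) , λ m n ≤m ≤n →
    let KL≤m = ℕ.m⊔n≤o⇒m≤o (K ℕ.⊔ L) (M ℕ.⊔ N) ≤m
        MN≤m = ℕ.m⊔n≤o⇒n≤o (K ℕ.⊔ L) (M ℕ.⊔ N) ≤m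
        KL≤n = ℕ.m⊔n≤o⇒m≤o (K ℕ.⊔ L) (M ℕ.⊔ N) ≤n
        MN≤n = ℕ.m⊔n≤o⇒n≤o (K ℕ.⊔ L) (M ℕ.⊔ N) ≤n
    in begin-strict
    ∣ x m * y m - x n * y n ∣
      ≡⟨ cong ∣_∣ (product-difference (x m) (y m) (x n) (y n)) ⟩
    ∣ x m * (y m - y n) + y n * (x m - x n) ∣
      ≤⟨ ∣p+q∣≤∣p∣+∣q∣ (x m * (y m - y n)) (y n * (x m - x n)) ⟩
    ∣ x m * (y m - y n) ∣ + ∣ y n * (x m - x n) ∣
      <⟨ +-mono-<
           (∣p*q∣<B*δ (x m) (y m - y n) 0<A (bx m (ℕ.m⊔n≤o⇒m≤o K L KL≤m))
             (hy m n (ℕ.m⊔n≤o⇒m≤o M N MN≤m) (ℕ.m⊔n≤o⇒m≤o M N MN≤n)))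
           (∣p*q∣<B*δ (y n) (x m - x n) 0<B (by n (ℕ.m⊔n≤o⇒n≤o K L KL≤n))
             (hx m n (ℕ.m⊔n≤o⇒n≤o M N MN≤m) (ℕ.m⊔n≤o⇒n≤o M N MN≤n))) ⟩
    A * α + B * β
      ≡⟨ cong₂ _+_ Aα≡ Bβ≡ ⟩
    ½ * ε + ½ * ε
      ≡⟨ ½+½ ε ⟩
    ε ∎
  where open ≤-Reasoning

0ʳ 1ʳ : ℝ
0ʳ = mkℝ (λ _ → 0ℚ) (constant-cauchy 0ℚ)
1ʳ = mkℝ (λ _ → 1ℚ) (constant-cauchy 1ℚ)

infixl 6 _+ʳ_
infixl 7 _*ʳ_
infix  8 -ʳ_

_+ʳ_ _*ʳ_ : ℝ → ℝ → ℝ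
x +ʳ y = mkℝ (λ n → seq x n + seq y n) (+-cauchy (seq x) (seq y) (cauchy x) (cauchy y))
x *ʳ y = mkℝ (λ n → seq x n * seq y n) (*-cauchy (seq x) (seq y) (cauchy x) (cauchy y))

-ʳ_ : ℝ → ℝ
-ʳ x = mkℝ (λ n → - seq x n) (neg-cauchy (seq x) (cauchy x))

record ℂ : Set where
  constructor _+i_
  field
    re im : ℝ

open ℂ public

ℂ-rawRing : RawRing 0ℓ 0ℓ
ℂ-rawRing = record
  { Carrier = ℂ
  ; _≈_     = λ z w → re z ≈ʳ re w × im z ≈ʳ im w
  ; _+_     = λ z w → (re z +ʳ re w) +i (im z +ʳ im w)
  ; _*_     = λ z w → (re z *ʳ re w +ʳ -ʳ (im z *ʳ im w)) +i (re z *ʳ im w +ʳ im z *ʳ re w)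
  ; -_      = λ z → (-ʳ re z) +i (-ʳ im z)
  ; 0#      = 0ʳ +i 0ʳ
  ; 1#      = 1ʳ +i 0ʳ
  }

private module C = RawRing ℂ-rawRing
open RawMonoidDefinitions C.+-rawMonoid using (sum)

Matrix : ℕ → Set
Matrix n = Vector (Vector ℂ n) n

infix 4 _≈ᴹ_
_≈ᴹ_ : ∀ {n} → Matrix n → Matrix n → Set
A ≈ᴹ B = ∀ i j → A i j C.≈ B i j

0ᴹ : ∀ {n} → Matrix n
0ᴹ i j = C.0#

infix 8 -ᴹ_
-ᴹ_ : ∀ {n} → Matrix n → Matrix n
(-ᴹ A) i j = C.- A i j

infixl 7 _*ᴹ_
_*ᴹ_ : ∀ {n} → Matrix n → Matrix n → Matrix n
(A *ᴹ B) i j = sum λ l → A i l C.* B l j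

Anticommuting : ∀ {n k} → (Fin k → Matrix n) → Set
Anticommuting e = ∀ i j → i ≢ j → e i *ᴹ e j ≈ᴹ -ᴹ (e j *ᴹ e i)

{-# OPTIONS --safe #-}

-- Suppose that w ᵀ eᵢ² v ≠ 0 for all i, which holds for generic vectors v and w.  The k × k matrix
-- M with entries w ᵀ eᵢ eⱼ v has rank at most n, and since the family anticommutes, M + M ᵀ is
-- diagonal with nonzero diagonal entries 2 w ᵀ eᵢ² v.  Hence k = rk (M + M ᵀ) ≤ 2n.
--
-- The bound k ≤ 2n is decidable, so it suffices to prove its double negation, and the argument may
-- use excluded middle.

module Submission where

open import Defs
open import Algebra.Bundles using (CommutativeRing; RawRing)
open import Algebra.Structures using (IsCommutativeRing)
open import Data.Fin.Base using (Fin; zero; suc; combine; punchIn; remQuot; splitAt)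
open import Data.Fin.Properties using (punchIn-injective; punchInᵢ≢i; remQuot-combine)
open import Data.Nat.Base using (ℕ; zero; suc; _≤_; z≤n; s≤s; _⊔_)
import Data.Nat.Base as ℕ
import Data.Nat.Properties as ℕ
open import Data.Product.Base using (∃; _×_; _,_; proj₁; proj₂)
open import Data.Rational.Base as ℚ using (ℚ; 0ℚ; 1ℚ; ½; _-_; ∣_∣)
import Data.Rational.Properties as ℚ
open import Data.Rational.Solver using (module +-*-Solver)
open import Data.Sum.Base using (inj₁; inj₂)
open import Data.Sum.Properties using ([,]-map)
open import Data.Vec.Functional using (Vector; _∷_; _++_)
open import Function.Base using (_∘_)
open import Level using (0ℓ)
open import Relation.Binary.PropositionalEquality as ≡ using (_≡_; _≢_; cong; subst)
open import Relation.Nullary.Decidable.Core using (yes; no; decidable-stable; ¬¬-excluded-middle)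
open import Relation.Nullary.Negation using (¬_; contradiction)

-- Finitely many thresholds have a maximum, and finitely many double negations can be opened one
-- after another while the goal is itself negated. This lets one natural number serve all `i` in
-- `generic-vector`.
eventually-all : ∀ {k p} {P : Fin k → ℕ → Set p} →
  (∀ i → ¬ ¬ ∃ λ N → ∀ M → N ≤ M → P i M) →
  ¬ ¬ ∃ λ N → ∀ M → N ≤ M → ∀ i → P i M
eventually-all {zero}  h ¬all = ¬all (0 , λ _ _ ())
eventually-all {suc k} h ¬all =
  h zero λ (K , hK) → eventually-all (h ∘ suc) λ (L , hL) →
  ¬all (K ⊔ L , λ M K⊔L≤M → λ where
    zero    → hK M (ℕ.m⊔n≤o⇒m≤o K L K⊔L≤M)
    (suc i) → hL M (ℕ.m⊔n≤o⇒n≤o K L K⊔L≤M) i)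

module LinearAlgebra {c ℓ} (R : CommutativeRing c ℓ) where

  open CommutativeRing R
    using (Carrier; _≈_; 0#; 1#; _+_; -_; refl; sym; trans; setoid; semiring; commutativeSemiring;
           +-cong; +-congˡ; +-congʳ; +-identityˡ; +-identityʳ; -‿inverseʳ;
           *-cong; *-congˡ; *-congʳ; *-comm; zeroˡ; zeroʳ; *-identityˡ; distribʳ)
    renaming (_*_ to _·_)
  open import Algebra.Properties.Semiring.Sum semiring
    using (sum; sum-cong-≋; ∑-distrib-+; ∑-comm; sum-replicate-zero; *-distribˡ-sum; *-distribʳ-sum)
  open import Algebra.Properties.Semiring.Mult semiring using (×-homo-+) renaming (_×_ to _×ⁿ_)
  open import Algebra.Solver.Ring.NaturalCoefficients.Default commutativeSemiring
    using (solve; _:=_; _:+_; _:*_)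
  open import Relation.Binary.Reasoning.Setoid setoid

  -- Pairings of vectors

  dot : ∀ {n} → Vector Carrier n → Vector Carrier n → Carrier
  dot x y = sum λ l → x l · y l

  dot-cong : ∀ {n} {x x′ y y′ : Vector Carrier n} →
    (∀ l → x l ≈ x′ l) → (∀ l → y l ≈ y′ l) → dot x y ≈ dot x′ y′
  dot-cong x≈x′ y≈y′ = sum-cong-≋ λ l → *-cong (x≈x′ l) (y≈y′ l)

  dot-comm : ∀ {n} (x y : Vector Carrier n) → dot x y ≈ dot y x
  dot-comm x y = sum-cong-≋ λ l → *-comm (x l) (y l)

  dot-zeroʳ : ∀ {n} (x : Vector Carrier n) {y} → (∀ l → y l ≈ 0#) → dot x y ≈ 0#
  dot-zeroʳ {n} x y≈0 =
    trans (sum-cong-≋ λ l → trans (*-congˡ (y≈0 l)) (zeroʳ (x l))) (sum-replicate-zero n)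

  dot-distribˡ-+ : ∀ {n} (x y z : Vector Carrier n) →
    dot x (λ l → y l + z l) ≈ dot x y + dot x z
  dot-distribˡ-+ x y z = trans
    (sum-cong-≋ λ l → solve 3 (λ a b c → a :* (b :+ c) := a :* b :+ a :* c) refl (x l) (y l) (z l))
    (∑-distrib-+ (λ l → x l · y l) (λ l → x l · z l))

  dot-linearˡ : ∀ {n} a b (x z y : Vector Carrier n) →
    dot (λ l → a · x l + b · z l) y ≈ a · dot x y + b · dot z y
  dot-linearˡ a b x z y = begin
    dot (λ l → a · x l + b · z l) y
      ≈⟨ sum-cong-≋ (λ l → solve 5 (λ a b x z y → (a :* x :+ b :* z) :* y
           := a :* (x :* y) :+ b :* (z :* y)) refl a b (x l) (z l) (y l)) ⟩
    sum (λ l → a · (x l · y l) + b · (z l · y l))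
      ≈⟨ ∑-distrib-+ (λ l → a · (x l · y l)) (λ l → b · (z l · y l)) ⟩
    sum (λ l → a · (x l · y l)) + sum (λ l → b · (z l · y l))
      ≈⟨ sym (+-cong (*-distribˡ-sum a (λ l → x l · y l)) (*-distribˡ-sum b (λ l → z l · y l))) ⟩
    a · dot x y + b · dot z y ∎

  -- This is (xᵀA)y = xᵀ(Ay), by exchanging the two sums. It is what lets wᵀ eᵢ eⱼ v be read as a
  -- pairing of wᵀ eᵢ with eⱼ v in dimension n.
  dot-assoc : ∀ {m n} (x : Vector Carrier m) (A : Fin m → Vector Carrier n) (y : Vector Carrier n) →
    dot (λ l → dot x λ p → A p l) y ≈ dot x λ p → dot (A p) y
  dot-assoc {m} {n} x A y = begin
    sum (λ l → sum (λ p → x p · A p l) · y l)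
      ≈⟨ sum-cong-≋ (λ l → *-distribʳ-sum (y l) (λ p → x p · A p l)) ⟩
    sum (λ l → sum λ p → x p · A p l · y l)
      ≈⟨ ∑-comm {n} {m} (λ l p → x p · A p l · y l) ⟩
    sum (λ p → sum λ l → x p · A p l · y l)
      ≈⟨ sum-cong-≋ (λ p → sum-cong-≋ λ l →
           solve 3 (λ a b c → a :* b :* c := a :* (b :* c)) refl (x p) (A p l) (y l)) ⟩
    sum (λ p → sum λ l → x p · (A p l · y l))
      ≈⟨ sum-cong-≋ (λ p → sym (*-distribˡ-sum (x p) (λ l → A p l · y l))) ⟩
    sum (λ p → x p · sum λ l → A p l · y l) ∎

  -- Serves to write each entry of M + Mᵀ, a sum of two pairings in dimension n, as one pairing in
  -- dimension 2n.
  dot-++ : ∀ {m n} (x y : Vector Carrier m) (x′ y′ : Vector Carrier n) →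
    dot (x ++ x′) (y ++ y′) ≈ dot x y + dot x′ y′
  dot-++ {zero}  x y x′ y′ = sym (+-identityˡ _)
  dot-++ {suc m} x y x′ y′ = begin
    x zero · y zero + dot ((x ++ x′) ∘ suc) ((y ++ y′) ∘ suc)
      ≈⟨ +-congˡ (dot-cong (tail-++ x x′) (tail-++ y y′)) ⟩
    x zero · y zero + dot ((x ∘ suc) ++ x′) ((y ∘ suc) ++ y′)
      ≈⟨ +-congˡ (dot-++ (x ∘ suc) (y ∘ suc) x′ y′) ⟩
    x zero · y zero + (dot (x ∘ suc) (y ∘ suc) + dot x′ y′)
      ≈⟨ solve 3 (λ a b c → a :+ (b :+ c) := a :+ b :+ c) refl _ _ _ ⟩
    dot x y + dot x′ y′ ∎
    where
    tail-++ : ∀ {m n} (u : Vector Carrier (suc m)) (v : Vector Carrier n) l →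
      (u ++ v) (suc l) ≈ ((u ∘ suc) ++ v) l
    tail-++ {m} u v l = CommutativeRing.reflexive R ([,]-map (splitAt m l))

  -- The combination z₀x - x₀z has head zero, so dropping its first coordinate does not change its
  -- pairing with `y`. Scaling by z₀ avoids a division.
  dot-eliminate : ∀ {m} (x z y : Vector Carrier (suc m)) →
    dot (λ l → z zero · x (suc l) + - x zero · z (suc l)) (y ∘ suc)
      ≈ z zero · dot x y + - x zero · dot z y
  dot-eliminate x z y = begin
    dot (λ l → z₀ · x (suc l) + - x₀ · z (suc l)) (y ∘ suc)
      ≈⟨ dot-linearˡ z₀ (- x₀) (x ∘ suc) (z ∘ suc) (y ∘ suc) ⟩
    z₀ · S + - x₀ · T
      -- The semiring solver sees `- x₀` as an atom, so the two cancelling head terms are inserted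
      -- by hand.
      ≈⟨ sym (+-identityˡ _) ⟩
    0# + (z₀ · S + - x₀ · T)
      ≈⟨ +-congʳ (sym (trans (*-congʳ (-‿inverseʳ x₀)) (zeroˡ _))) ⟩
    (x₀ + - x₀) · (z₀ · y₀) + (z₀ · S + - x₀ · T)
      ≈⟨ solve 6 (λ x n z y S T → (x :+ n) :* (z :* y) :+ (z :* S :+ n :* T)
           := z :* (x :* y :+ S) :+ n :* (z :* y :+ T)) refl x₀ (- x₀) z₀ y₀ S T ⟩
    z₀ · dot x y + - x₀ · dot z y ∎
    where
    x₀ = x zero
    y₀ = y zero
    z₀ = z zero
    S = dot (x ∘ suc) (y ∘ suc)
    T = dot (z ∘ suc) (y ∘ suc)

  -- Biorthogonal systems and dimension

  module _
    -- These two properties replace the inverses of a field: elimination only rescales by the pivot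
    -- and later cancels it.
    (≈0-stable : ∀ {x} → ¬ ¬ x ≈ 0# → x ≈ 0#)
    (cancel : ∀ {x y} → ¬ x ≈ 0# → x · y ≈ 0# → y ≈ 0#)
    where

    -- Gaussian elimination on the first coordinate of the vectors x i.  Apart from rescaling, adding
    -- a multiple of x p to the other x i does not change their pairings with the y j, j ≢ p.
    biorthogonal⇒≤ : ∀ {m k} (x y : Fin k → Vector Carrier m) →
      (∀ i → ¬ dot (x i) (y i) ≈ 0#) → (∀ i j → i ≢ j → dot (x i) (y j) ≈ 0#) → k ≤ m
    biorthogonal⇒≤ {_}     {zero}  x y diagonal off = z≤n
    biorthogonal⇒≤ {zero}  {suc k} x y diagonal off = contradiction refl (diagonal zero)
    biorthogonal⇒≤ {suc m} {suc k} x y diagonal off =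
      decidable-stable (suc k ℕ.≤? suc m) λ ¬goal →
      ¬¬-excluded-middle {A = ∃ λ p → ¬ x p zero ≈ 0#} λ where
        (yes (p , xp≉0)) → ¬goal (s≤s (pivot p xp≉0))
        -- Without a pivot the first coordinate contributes to no pairing. Dropping it keeps all
        -- `suc k` vectors, which gives the stronger bound `suc k ≤ m`.
        (no ¬pivot) → ¬goal (ℕ.m≤n⇒m≤1+n (drop λ i → ≈0-stable λ xi≉0 → ¬pivot (i , xi≉0)))
      where
      drop : (∀ i → x i zero ≈ 0#) → suc k ≤ m
      drop x₀≈0 = biorthogonal⇒≤ (λ i → x i ∘ suc) (λ i → y i ∘ suc)
        (λ i → diagonal i ∘ trans (dot-tail i i))
        (λ i j i≢j → trans (sym (dot-tail i j)) (off i j i≢j))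
        where
        dot-tail : ∀ i j → dot (x i) (y j) ≈ dot (x i ∘ suc) (y j ∘ suc)
        dot-tail i j = trans (+-congʳ (trans (*-congʳ (x₀≈0 i)) (zeroˡ _))) (+-identityˡ _)

      pivot : ∀ p → ¬ x p zero ≈ 0# → k ≤ m
      pivot p xp≉0 = biorthogonal⇒≤
        (λ i l → x p zero · x (punchIn p i) (suc l) + - x (punchIn p i) zero · x p (suc l))
        (λ j → y (punchIn p j) ∘ suc)
        (λ i → diagonal (punchIn p i) ∘ cancel xp≉0 ∘ trans (sym (reduced i i)))
        (λ i j i≢j → trans (reduced i j) (trans
          (*-congˡ (off _ _ (i≢j ∘ punchIn-injective p i j))) (zeroʳ _)))
        where
        reduced : ∀ i j → dot _ (y (punchIn p j) ∘ suc) ≈ x p zero · dot (x (punchIn p i)) (y (punchIn p j))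
        reduced i j = begin
          dot _ (y (punchIn p j) ∘ suc)
            ≈⟨ dot-eliminate (x (punchIn p i)) (x p) (y (punchIn p j)) ⟩
          _ + - x (punchIn p i) zero · dot (x p) (y (punchIn p j))
            ≈⟨ +-congˡ (trans (*-congˡ (off _ _ (punchInᵢ≢i p j ∘ ≡.sym))) (zeroʳ _)) ⟩
          _ + 0#
            ≈⟨ +-identityʳ _ ⟩
          x p zero · dot (x (punchIn p i)) (y (punchIn p j)) ∎

    -- Generic vectors in characteristic 0

    module _ (characteristic-0 : ∀ n → ¬ suc n ×ⁿ 1# ≈ 0#) where

      x+x≈0⇒x≈0 : ∀ {x} → x + x ≈ 0# → x ≈ 0#
      x+x≈0⇒x≈0 {x} x+x≈0 = cancel (characteristic-0 1) (begin
        (1# + (1# + 0#)) · x  ≈⟨ *-congʳ (+-congˡ (+-identityʳ 1#)) ⟩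
        (1# + 1#) · x         ≈⟨ distribʳ x 1# 1# ⟩
        1# · x + 1# · x       ≈⟨ +-cong (*-identityˡ x) (*-identityˡ x) ⟩
        x + x                 ≈⟨ x+x≈0 ⟩
        0#                    ∎)

      -- Subtracting the two equations leaves (d + 1)a = 0, and d + 1 is nonzero in characteristic
      -- 0.
      affine-root-unique : ∀ {a b} N d →
        (N ×ⁿ 1#) · a + b ≈ 0# → ((suc d ℕ.+ N) ×ⁿ 1#) · a + b ≈ 0# → a ≈ 0#
      affine-root-unique {a} {b} N d root root′ = cancel (characteristic-0 d) (begin
        D · a                          ≈⟨ sym (+-identityʳ _) ⟩
        D · a + 0#                     ≈⟨ +-congˡ (sym root) ⟩
        D · a + ((N ×ⁿ 1#) · a + b)    ≈⟨ solve 4 (λ D N a b → D :* a :+ (N :* a :+ b)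
                                            := (D :+ N) :* a :+ b) refl D (N ×ⁿ 1#) a b ⟩
        (D + N ×ⁿ 1#) · a + b          ≈⟨ +-congʳ (*-congʳ (sym (×-homo-+ 1# (suc d) N))) ⟩
        ((suc d ℕ.+ N) ×ⁿ 1#) · a + b  ≈⟨ root′ ⟩
        0#                             ∎)
        where D = suc d ×ⁿ 1#

      -- If there is a natural root, a further root beyond it forces the slope `a` to vanish; if
      -- there is none, every threshold works. Choosing between the cases takes excluded middle,
      -- hence the double negation.
      affine-eventually-nonzero : ∀ a b →
        ¬ ¬ ∃ λ N → ∀ M → N ≤ M → (M ×ⁿ 1#) · a + b ≈ 0# → a ≈ 0#
      affine-eventually-nonzero a b ¬goal =
        ¬¬-excluded-middle {A = ∃ λ N → (N ×ⁿ 1#) · a + b ≈ 0#} λ where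
        -- The threshold is `suc N` because the two roots must differ: then M = suc d + N with d =
        -- `M ∸ suc N`.
        (yes (N , root)) → ¬goal (suc N , λ M N<M root′ →
          affine-root-unique N (M ℕ.∸ suc N) root
            (subst (λ K → (K ×ⁿ 1#) · a + b ≈ 0#)
              (≡.sym (≡.trans (≡.sym (ℕ.+-suc (M ℕ.∸ suc N) N)) (ℕ.m∸n+n≡m N<M))) root′))
        (no ¬root) → ¬goal (0 , λ M _ root → contradiction (M , root) ¬root)

      -- A vector a i with nonzero head excludes at most one value of the head of v, which is taken in ℕ.
      generic-vector : ∀ {k} n (a : Fin k → Vector Carrier n) →
        ¬ ¬ ∃ λ v → ∀ i → dot v (a i) ≈ 0# → ∀ l → a i l ≈ 0#
      generic-vector zero    a ¬goal = ¬goal ((λ ()) , λ _ _ ())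
      generic-vector (suc n) a ¬goal =
        generic-vector n (λ i → a i ∘ suc) λ (v , generic) →
        eventually-all (λ i → affine-eventually-nonzero (a i zero) (dot v (a i ∘ suc))) λ (N , heads) →
        ¬goal ((N ×ⁿ 1#) ∷ v , λ i dot≈0 →
          let head≈0 = heads N ℕ.≤-refl i dot≈0 in λ where
            zero    → head≈0
            -- Once the head of `a i` vanishes, the new head of the vector no longer contributes,
            -- and genericity of `v` for the tails applies.
            (suc l) → generic i (begin
              dot v (a i ∘ suc)
                ≈⟨ sym (+-identityˡ _) ⟩
              0# + dot v (a i ∘ suc)
                ≈⟨ +-congʳ (sym (trans (*-congˡ head≈0) (zeroʳ _))) ⟩
              (N ×ⁿ 1#) · a i zero + dot v (a i ∘ suc)
                ≈⟨ dot≈0 ⟩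
              0# ∎) l)

      -- First `v` is chosen generic for all k * n rows of the matrices, listed as one family
      -- through `combine`; then `w` is chosen generic for the k vectors Aᵢv. So wᵀAᵢv = 0 forces
      -- Aᵢv = 0, and this forces every row of Aᵢ to vanish.
      generic-vectors : ∀ {k n} (A : Fin k → Fin n → Vector Carrier n) →
        ¬ ¬ ∃ λ w → ∃ λ v → ∀ i → dot w (λ p → dot (A i p) v) ≈ 0# → ∀ p q → A i p q ≈ 0#
      generic-vectors {k} {n} A ¬goal =
        generic-vector {k ℕ.* n} n row λ (v , v-generic) →
        generic-vector n (λ i p → dot (A i p) v) λ (w , w-generic) →
        ¬goal (w , v , λ i dot≈0 p q →
          subst (λ u → u q ≈ 0#) (row-combine i p)
            (v-generic (combine i p)
              (subst (λ u → dot v u ≈ 0#) (≡.sym (row-combine i p))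
                (trans (dot-comm v (A i p)) (w-generic i dot≈0 p)))
              q))
        where
        row : Fin (k ℕ.* n) → Vector Carrier n
        row r = let i , p = remQuot n r in A i p

        row-combine : ∀ i p → row (combine i p) ≡ A i p
        row-combine i p = cong (λ (j , q) → A j q) (remQuot-combine i p)

      -- The bound for anticommuting families

      anticommuting⇒≤ : ∀ {n k} (e : Fin k → Fin n → Vector Carrier n) →
        (∀ i j → i ≢ j → ∀ p q → dot (e i p) (λ l → e j l q) ≈ - dot (e j p) (λ l → e i l q)) →
        (∀ i → ¬ (∀ p q → dot (e i p) (λ l → e i l q) ≈ 0#)) → k ≤ n ℕ.+ n
      anticommuting⇒≤ {n} {k} e anti square≉0 =
        decidable-stable (k ℕ.≤? (n ℕ.+ n)) λ ¬goal →
        generic-vectors (λ i → i ∙ i) λ (w , v , generic) →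
        -- `left i` is wᵀ eᵢ and `right j` is eⱼ v. Swapping the two halves in the second system
        -- makes the pairing of the i-th with the j-th vector equal to the entry (i, j) of M + Mᵀ.
        let left  = λ i l → dot w (λ p → e i p l)
            right = λ j l → dot (e j l) v

            entry : ∀ i j → dot (left i) (right j) ≈ dot w (λ p → dot ((i ∙ j) p) v)
            entry i j = trans (dot-assoc w (e i) (right j))
              (dot-cong (λ _ → refl) λ p → sym (dot-assoc (e i p) (e j) v))

            symmetrized : ∀ i j → dot (left i ++ right i) (right j ++ left j)
              ≈ dot w (λ p → dot ((i ∙ j) p) v) + dot w (λ p → dot ((j ∙ i) p) v)
            symmetrized i j = trans (dot-++ (left i) (right j) (right i) (left j))
              (+-cong (entry i j) (trans (dot-comm (right i) (left j)) (entry j i)))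
        in
        ¬goal (biorthogonal⇒≤ (λ i → left i ++ right i) (λ j → right j ++ left j)
          (λ i → square≉0 i ∘ generic i ∘ x+x≈0⇒x≈0 ∘ trans (sym (symmetrized i i)))
          (λ i j i≢j → trans (symmetrized i j) (trans
            (sym (dot-distribˡ-+ w (λ p → dot ((i ∙ j) p) v) (λ p → dot ((j ∙ i) p) v)))
            -- Off the diagonal the entry is wᵀ(eᵢeⱼ + eⱼeᵢ)v, where the matrix in the middle is
            -- zero.
            (dot-zeroʳ w λ p → begin
              dot ((i ∙ j) p) v + dot ((j ∙ i) p) v
                ≈⟨ +-cong (dot-comm ((i ∙ j) p) v) (dot-comm ((j ∙ i) p) v) ⟩
              dot v ((i ∙ j) p) + dot v ((j ∙ i) p)
                ≈⟨ sym (dot-distribˡ-+ v ((i ∙ j) p) ((j ∙ i) p)) ⟩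
              dot v (λ q → (i ∙ j) p q + (j ∙ i) p q)
                ≈⟨ dot-zeroʳ v (λ q → trans (+-congʳ (anti i j i≢j p q)) (CommutativeRing.-‿inverseˡ R _)) ⟩
              0# ∎))))
        where
        _∙_ : Fin k → Fin k → Fin n → Vector Carrier n
        _∙_ i j p q = dot (e i p) (λ l → e j l q)

module ComplexNumbers where

  open import Data.Rational.Base using (_+_; _*_; -_; _<_)
  open +-*-Solver using (solve; _:=_; _:+_; _:*_; :-_; _:-_; con)

  -- Null sequences and equality of reals

  <⇒≱ : ∀ {p q} → p < q → ¬ q ℚ.≤ p
  <⇒≱ p<q q≤p = ℚ.<-irrefl ≡.refl (ℚ.<-≤-trans p<q q≤p)

  0<p*q : ∀ {p q} → 0ℚ < p → 0ℚ < q → 0ℚ < p * q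
  0<p*q {p} {q} 0<p 0<q =
    ℚ.positive⁻¹ (p * q) {{ℚ.pos*pos⇒pos p {{ℚ.positive 0<p}} q {{ℚ.positive 0<q}}}}

  -- By definition `x ≈ʳ y` is `Null` of the termwise difference. Facts about real equality thus
  -- reduce to rational identities, carried over by `null-cong`.
  Null : (ℕ → ℚ) → Set
  Null s = ∀ ε → 0ℚ < ε → ∃ λ N → ∀ n → N ≤ n → ∣ s n ∣ < ε

  null-cong : ∀ {s t} → (∀ n → s n ≡ t n) → Null s → Null t
  null-cong s≡t null ε 0<ε with N , h ← null ε 0<ε
    = N , λ n N≤n → subst (λ q → ∣ q ∣ < ε) (s≡t n) (h n N≤n)

  null-0 : Null (λ _ → 0ℚ)
  null-0 ε 0<ε = 0 , λ _ _ → 0<ε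

  null-neg : ∀ {s} → Null s → Null (λ n → - s n)
  null-neg {s} null ε 0<ε with N , h ← null ε 0<ε
    = N , λ n N≤n → subst (_< ε) (≡.sym (ℚ.∣-p∣≡∣p∣ (s n))) (h n N≤n)

  null-+ : ∀ {s t} → Null s → Null t → Null (λ n → s n + t n)
  null-+ {s} {t} s-null t-null ε 0<ε
    with M , hs ← s-null (½ * ε) (0<½* 0<ε)
       | N , ht ← t-null (½ * ε) (0<½* 0<ε)
    = M ⊔ N , λ n ≤n → begin-strict
      ∣ s n + t n ∣      ≤⟨ ℚ.∣p+q∣≤∣p∣+∣q∣ (s n) (t n) ⟩
      ∣ s n ∣ + ∣ t n ∣  <⟨ ℚ.+-mono-< (hs n (ℕ.m⊔n≤o⇒m≤o M N ≤n)) (ht n (ℕ.m⊔n≤o⇒n≤o M N ≤n)) ⟩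
      ½ * ε + ½ * ε      ≡⟨ ½+½ ε ⟩
      ε                  ∎
    where open ℚ.≤-Reasoning

  -- A Cauchy sequence is eventually below some B in absolute value, so it suffices that `t` gets
  -- below ε/B.
  null-*ˡ : ∀ x {t} → Null t → Null (λ n → seq x n * t n)
  null-*ˡ x {t} null ε 0<ε
    with B , 0<B , M , bound ← eventually-bounded (cauchy x)
    with δ , 0<δ , Bδ≡ε ← shrink 0<B 0<ε
    with N , h ← null δ 0<δ
    = M ⊔ N , λ n ≤n → subst (∣ seq x n * t n ∣ <_) Bδ≡ε
        (∣p*q∣<B*δ (seq x n) (t n) 0<B (bound n (ℕ.m⊔n≤o⇒m≤o M N ≤n)) (h n (ℕ.m⊔n≤o⇒n≤o M N ≤n)))

  p-0≡p : ∀ p → p - 0ℚ ≡ p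
  p-0≡p = ℚ.+-identityʳ

  ≈0⇒null : ∀ {x} → x ≈ʳ 0ʳ → Null (seq x)
  ≈0⇒null {x} = null-cong (λ n → p-0≡p (seq x n))

  null⇒≈0 : ∀ {x} → Null (seq x) → x ≈ʳ 0ʳ
  null⇒≈0 {x} = null-cong (λ n → ≡.sym (p-0≡p (seq x n)))

  pointwise : ∀ {x y} → (∀ n → seq x n ≡ seq y n) → x ≈ʳ y
  pointwise {x} {y} x≡y = null-cong
    (λ n → ≡.trans (≡.sym (ℚ.+-inverseʳ (seq y n))) (cong (_- seq y n) (≡.sym (x≡y n)))) null-0

  ≈ʳ-refl : ∀ {x} → x ≈ʳ x
  ≈ʳ-refl {x} = pointwise {x} {x} λ _ → ≡.refl

  ≈ʳ-sym : ∀ {x y} → x ≈ʳ y → y ≈ʳ x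
  ≈ʳ-sym {x} {y} x≈y = null-cong
    (λ n → solve 2 (λ a b → :- (a :- b) := b :- a) ≡.refl (seq x n) (seq y n))
    (null-neg x≈y)

  ≈ʳ-trans : ∀ {x y z} → x ≈ʳ y → y ≈ʳ z → x ≈ʳ z
  ≈ʳ-trans {x} {y} {z} x≈y y≈z = null-cong
    (λ n → solve 3 (λ a b c → (a :- b) :+ (b :- c) := a :- c) ≡.refl (seq x n) (seq y n) (seq z n))
    (null-+ x≈y y≈z)

  +ʳ-cong : ∀ {x x′ y y′} → x ≈ʳ x′ → y ≈ʳ y′ → x +ʳ y ≈ʳ x′ +ʳ y′
  +ʳ-cong {x} {x′} {y} {y′} x≈x′ y≈y′ = null-cong
    (λ n → ≡.sym (sum-difference (seq x n) (seq y n) (seq x′ n) (seq y′ n)))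
    (null-+ x≈x′ y≈y′)

  -ʳ-cong : ∀ {x x′} → x ≈ʳ x′ → -ʳ x ≈ʳ -ʳ x′
  -ʳ-cong {x} {x′} x≈x′ = null-cong
    (λ n → ℚ.neg-distrib-+ (seq x n) (- seq x′ n))
    (null-neg x≈x′)

  *ʳ-cong : ∀ {x x′ y y′} → x ≈ʳ x′ → y ≈ʳ y′ → x *ʳ y ≈ʳ x′ *ʳ y′
  *ʳ-cong {x} {x′} {y} {y′} x≈x′ y≈y′ = null-cong
    (λ n → ≡.sym (product-difference (seq x n) (seq y n) (seq x′ n) (seq y′ n)))
    (null-+ (null-*ˡ x y≈y′) (null-*ˡ y′ x≈x′))

  -- Sequences bounded away from zero

  BoundedAway : (ℕ → ℚ) → Set
  BoundedAway s = ∃ λ δ → 0ℚ < δ × ∃ λ N → ∀ n → N ≤ n → δ ℚ.≤ ∣ s n ∣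

  null⇒¬boundedAway : ∀ {s} → Null s → ¬ BoundedAway s
  null⇒¬boundedAway null (δ , 0<δ , M , h) with N , h′ ← null δ 0<δ
    = <⇒≱ (h′ (M ⊔ N) (ℕ.m≤n⊔m M N)) (h (M ⊔ N) (ℕ.m≤m⊔n M N))

  -- Beyond N the terms differ by less than ε/4, and comparing the single rational ∣s N∣ with ε/2 is
  -- decidable. If it is smaller, all later terms are below ε; otherwise they all stay at least ε/4
  -- away from zero.
  ¬boundedAway⇒null : ∀ {s} → Cauchy s → ¬ BoundedAway s → Null s
  ¬boundedAway⇒null {s} s-cauchy ¬away ε 0<ε
    with N , h ← s-cauchy (½ * (½ * ε)) (0<½* (0<½* 0<ε))
    with ∣ s N ∣ ℚ.<? ½ * ε
  ... | yes small = N , λ n N≤n → begin-strict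
      ∣ s n ∣                        ≡⟨ cong ∣_∣ (≡.sym (p-q+q≡p (s n) (s N))) ⟩
      ∣ (s n - s N) + s N ∣          ≤⟨ ℚ.∣p+q∣≤∣p∣+∣q∣ (s n - s N) (s N) ⟩
      ∣ s n - s N ∣ + ∣ s N ∣        <⟨ ℚ.+-mono-< (h n N N≤n ℕ.≤-refl) small ⟩
      ½ * (½ * ε) + ½ * ε            ≤⟨ ℚ.+-monoˡ-≤ (½ * ε) (ℚ.*-monoˡ-≤-nonNeg ½ ½ε≤ε) ⟩
      ½ * ε + ½ * ε                  ≡⟨ ½+½ ε ⟩
      ε                              ∎
      where
      open ℚ.≤-Reasoning
      ½ε≤ε : ½ * ε ℚ.≤ ε
      ½ε≤ε = begin
        ½ * ε          ≡⟨ ≡.sym (ℚ.+-identityʳ (½ * ε)) ⟩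
        ½ * ε + 0ℚ     ≤⟨ ℚ.+-monoʳ-≤ (½ * ε) (ℚ.<⇒≤ (0<½* 0<ε)) ⟩
        ½ * ε + ½ * ε  ≡⟨ ½+½ ε ⟩
        ε              ∎
  ... | no large = contradiction
      (½ * (½ * ε) , 0<½* (0<½* 0<ε) , N , λ n N≤n → ℚ.≮⇒≥ λ sn<¼ε → large (begin-strict
        ∣ s N ∣                    ≡⟨ cong ∣_∣ (≡.sym (p-q+q≡p (s N) (s n))) ⟩
        ∣ (s N - s n) + s n ∣      ≤⟨ ℚ.∣p+q∣≤∣p∣+∣q∣ (s N - s n) (s n) ⟩
        ∣ s N - s n ∣ + ∣ s n ∣    <⟨ ℚ.+-mono-< (h N n ℕ.≤-refl N≤n) sn<¼ε ⟩
        ½ * (½ * ε) + ½ * (½ * ε)  ≡⟨ ½+½ (½ * ε) ⟩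
        ½ * ε                      ∎))
      ¬away
      where open ℚ.≤-Reasoning

  -- For Cauchy sequences, being null is equivalent to the negation of being bounded away, and
  -- negations are stable.
  null-stable : ∀ {s} → Cauchy s → ¬ ¬ Null s → Null s
  null-stable s-cauchy ¬¬null =
    ¬boundedAway⇒null s-cauchy λ away → ¬¬null λ null → null⇒¬boundedAway null away

  boundedAway-cancel : ∀ {s t} → BoundedAway s → Null (λ n → s n * t n) → Null t
  boundedAway-cancel {s} {t} (δ , 0<δ , M , away) null ε 0<ε
    with N , h ← null (δ * ε) (0<p*q 0<δ 0<ε)
    = M ⊔ N , λ n ≤n → ℚ.≰⇒> λ ε≤tn →
      <⇒≱ (h n (ℕ.m⊔n≤o⇒n≤o M N ≤n)) (begin
        δ * ε              ≤⟨ ℚ.*-monoˡ-≤-nonNeg δ {{ℚ.nonNegative (ℚ.<⇒≤ 0<δ)}} ε≤tn ⟩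
        δ * ∣ t n ∣        ≤⟨ ℚ.*-monoʳ-≤-nonNeg ∣ t n ∣ {{ℚ.∣-∣-nonNeg (t n)}} (away n (ℕ.m⊔n≤o⇒m≤o M N ≤n)) ⟩
        ∣ s n ∣ * ∣ t n ∣  ≡⟨ ≡.sym (ℚ.∣p*q∣≡∣p∣*∣q∣ (s n) (t n)) ⟩
        ∣ s n * t n ∣      ∎)
    where open ℚ.≤-Reasoning

  -- From `¬ Null s` one obtains only the double negation of `BoundedAway s`. This is enough, since
  -- the conclusion is stable.
  null-cancel : ∀ {s t} → Cauchy s → Cauchy t → ¬ Null s → Null (λ n → s n * t n) → Null t
  null-cancel s-cauchy t-cauchy s≉0 null = null-stable t-cauchy λ ¬null →
    s≉0 (¬boundedAway⇒null s-cauchy λ away → ¬null (boundedAway-cancel away null))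

  ∣p∣*∣p∣≡p*p : ∀ p → ∣ p ∣ * ∣ p ∣ ≡ p * p
  ∣p∣*∣p∣≡p*p p with ℚ.∣p∣≡p∨∣p∣≡-p p
  ... | inj₁ ∣p∣≡p  = ≡.cong₂ _*_ ∣p∣≡p ∣p∣≡p
  ... | inj₂ ∣p∣≡-p = ≡.trans (≡.cong₂ _*_ ∣p∣≡-p ∣p∣≡-p)
    (solve 1 (λ a → :- a :* :- a := a :* a) ≡.refl p)

  0≤p*p : ∀ p → 0ℚ ℚ.≤ p * p
  0≤p*p p = subst (0ℚ ℚ.≤_) (≡.trans (ℚ.∣p*q∣≡∣p∣*∣q∣ p p) (∣p∣*∣p∣≡p*p p)) (ℚ.0≤∣p∣ (p * p))

  -- A term with ∣s n∣ ≥ ε would make the sum at least ε². Applied to ∣z∣², this shows that a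
  -- nonzero z has nonzero modulus.
  null-sum-of-squares : ∀ {s t : ℕ → ℚ} → Null (λ n → s n * s n + t n * t n) → Null s
  null-sum-of-squares {s} {t} null ε 0<ε
    with N , h ← null (ε * ε) (0<p*q 0<ε 0<ε)
    = N , λ n N≤n → ℚ.≰⇒> λ ε≤sn → <⇒≱ (h n N≤n) (begin
      ε * ε                        ≤⟨ ℚ.*-monoˡ-≤-nonNeg ε {{ℚ.nonNegative (ℚ.<⇒≤ 0<ε)}} ε≤sn ⟩
      ε * ∣ s n ∣                  ≤⟨ ℚ.*-monoʳ-≤-nonNeg ∣ s n ∣ {{ℚ.∣-∣-nonNeg (s n)}} ε≤sn ⟩
      ∣ s n ∣ * ∣ s n ∣            ≡⟨ ∣p∣*∣p∣≡p*p (s n) ⟩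
      s n * s n                    ≡⟨ ≡.sym (ℚ.+-identityʳ (s n * s n)) ⟩
      s n * s n + 0ℚ               ≤⟨ ℚ.+-monoʳ-≤ (s n * s n) (0≤p*p (t n)) ⟩
      s n * s n + t n * t n        ≡⟨ ≡.sym (ℚ.0≤p⇒∣p∣≡p (ℚ.+-mono-≤ (0≤p*p (s n)) (0≤p*p (t n)))) ⟩
      ∣ s n * s n + t n * t n ∣    ∎)
    where open ℚ.≤-Reasoning

  -- The ring of complex numbers

  open RawRing ℂ-rawRing using () renaming
    (_≈_ to _≈ᶜ_; _+_ to _+ᶜ_; _*_ to _*ᶜ_; -_ to -ᶜ_; 0# to 0ᶜ; 1# to 1ᶜ)

  isCommutativeRing : IsCommutativeRing _≈ᶜ_ _+ᶜ_ _*ᶜ_ -ᶜ_ 0ᶜ 1ᶜ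
  isCommutativeRing = record
    { isRing = record
      { +-isAbelianGroup = record
        { isGroup = record
          { isMonoid = record
            { isSemigroup = record
              { isMagma = record
                { isEquivalence = record
                  { refl  = λ {z} → ≈ʳ-refl {re z} , ≈ʳ-refl {im z}
                  ; sym   = λ {z} {w} (r , i) →
                      ≈ʳ-sym {re z} {re w} r , ≈ʳ-sym {im z} {im w} i
                  ; trans = λ {z} {w} {u} (r , i) (r′ , i′) →
                      ≈ʳ-trans {re z} {re w} {re u} r r′ , ≈ʳ-trans {im z} {im w} {im u} i i′
                  }
                ; ∙-cong = λ {z} {z′} {w} {w′} (r , i) (r′ , i′) →
                    +ʳ-cong {re z} {re z′} {re w} {re w′} r r′ ,
                    +ʳ-cong {im z} {im z′} {im w} {im w′} i i′
                }
              ; assoc = λ z w u →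
                  pointwiseᶜ ((z +ᶜ w) +ᶜ u) (z +ᶜ (w +ᶜ u))
                    (λ n → ℚ.+-assoc (seq (re z) n) (seq (re w) n) (seq (re u) n))
                    (λ n → ℚ.+-assoc (seq (im z) n) (seq (im w) n) (seq (im u) n))
              }
            ; identity =
                (λ z → pointwiseᶜ (0ᶜ +ᶜ z) z
                  (λ n → ℚ.+-identityˡ (seq (re z) n)) (λ n → ℚ.+-identityˡ (seq (im z) n))) ,
                (λ z → pointwiseᶜ (z +ᶜ 0ᶜ) z
                  (λ n → ℚ.+-identityʳ (seq (re z) n)) (λ n → ℚ.+-identityʳ (seq (im z) n)))
            }
          ; inverse =
              (λ z → pointwiseᶜ (-ᶜ z +ᶜ z) 0ᶜ
                (λ n → ℚ.+-inverseˡ (seq (re z) n)) (λ n → ℚ.+-inverseˡ (seq (im z) n))) ,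
              (λ z → pointwiseᶜ (z +ᶜ -ᶜ z) 0ᶜ
                (λ n → ℚ.+-inverseʳ (seq (re z) n)) (λ n → ℚ.+-inverseʳ (seq (im z) n)))
          ; ⁻¹-cong = λ {z} {w} (r , i) → -ʳ-cong {re z} {re w} r , -ʳ-cong {im z} {im w} i
          }
        ; comm = λ z w → pointwiseᶜ (z +ᶜ w) (w +ᶜ z)
            (λ n → ℚ.+-comm (seq (re z) n) (seq (re w) n))
            (λ n → ℚ.+-comm (seq (im z) n) (seq (im w) n))
        }
      ; *-cong = λ {z} {z′} {w} {w′} (r , i) (r′ , i′) →
          +ʳ-cong {re z *ʳ re w} {re z′ *ʳ re w′} { -ʳ (im z *ʳ im w)} { -ʳ (im z′ *ʳ im w′)}
            (*ʳ-cong {re z} {re z′} {re w} {re w′} r r′)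
            (-ʳ-cong {im z *ʳ im w} {im z′ *ʳ im w′} (*ʳ-cong {im z} {im z′} {im w} {im w′} i i′)) ,
          +ʳ-cong {re z *ʳ im w} {re z′ *ʳ im w′} {im z *ʳ re w} {im z′ *ʳ re w′}
            (*ʳ-cong {re z} {re z′} {im w} {im w′} r i′)
            (*ʳ-cong {im z} {im z′} {re w} {re w′} i r′)
      ; *-assoc = λ z w u → pointwiseᶜ ((z *ᶜ w) *ᶜ u) (z *ᶜ (w *ᶜ u))
          (λ n → solve 6 (λ a b c d e f →
            (a :* c :+ :- (b :* d)) :* e :+ :- ((a :* d :+ b :* c) :* f)
              := a :* (c :* e :+ :- (d :* f)) :+ :- (b :* (c :* f :+ d :* e))) ≡.refl
            (seq (re z) n) (seq (im z) n) (seq (re w) n) (seq (im w) n) (seq (re u) n) (seq (im u) n))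
          (λ n → solve 6 (λ a b c d e f →
            (a :* c :+ :- (b :* d)) :* f :+ (a :* d :+ b :* c) :* e
              := a :* (c :* f :+ d :* e) :+ b :* (c :* e :+ :- (d :* f))) ≡.refl
            (seq (re z) n) (seq (im z) n) (seq (re w) n) (seq (im w) n) (seq (re u) n) (seq (im u) n))
      ; *-identity =
          (λ z → pointwiseᶜ (1ᶜ *ᶜ z) z
            (λ n → solve 2 (λ a b → con 1ℚ :* a :+ :- (con 0ℚ :* b) := a) ≡.refl
              (seq (re z) n) (seq (im z) n))
            (λ n → solve 2 (λ a b → con 1ℚ :* b :+ con 0ℚ :* a := b) ≡.refl
              (seq (re z) n) (seq (im z) n))) ,
          (λ z → pointwiseᶜ (z *ᶜ 1ᶜ) z
            (λ n → solve 2 (λ a b → a :* con 1ℚ :+ :- (b :* con 0ℚ) := a) ≡.refl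
              (seq (re z) n) (seq (im z) n))
            (λ n → solve 2 (λ a b → a :* con 0ℚ :+ b :* con 1ℚ := b) ≡.refl
              (seq (re z) n) (seq (im z) n)))
      ; distrib =
          (λ z w u → pointwiseᶜ (z *ᶜ (w +ᶜ u)) (z *ᶜ w +ᶜ z *ᶜ u)
            (λ n → solve 6 (λ a b c d e f → a :* (c :+ e) :+ :- (b :* (d :+ f))
              := (a :* c :+ :- (b :* d)) :+ (a :* e :+ :- (b :* f))) ≡.refl
              (seq (re z) n) (seq (im z) n) (seq (re w) n) (seq (im w) n) (seq (re u) n) (seq (im u) n))
            (λ n → solve 6 (λ a b c d e f → a :* (d :+ f) :+ b :* (c :+ e)
              := (a :* d :+ b :* c) :+ (a :* f :+ b :* e)) ≡.refl
              (seq (re z) n) (seq (im z) n) (seq (re w) n) (seq (im w) n) (seq (re u) n) (seq (im u) n))) ,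
          (λ z w u → pointwiseᶜ ((w +ᶜ u) *ᶜ z) (w *ᶜ z +ᶜ u *ᶜ z)
            (λ n → solve 6 (λ a b c d e f → (c :+ e) :* a :+ :- ((d :+ f) :* b)
              := (c :* a :+ :- (d :* b)) :+ (e :* a :+ :- (f :* b))) ≡.refl
              (seq (re z) n) (seq (im z) n) (seq (re w) n) (seq (im w) n) (seq (re u) n) (seq (im u) n))
            (λ n → solve 6 (λ a b c d e f → (c :+ e) :* b :+ (d :+ f) :* a
              := (c :* b :+ d :* a) :+ (e :* b :+ f :* a)) ≡.refl
              (seq (re z) n) (seq (im z) n) (seq (re w) n) (seq (im w) n) (seq (re u) n) (seq (im u) n)))
      }
    ; *-comm = λ z w → pointwiseᶜ (z *ᶜ w) (w *ᶜ z)
        (λ n → solve 4 (λ a b c d → a :* c :+ :- (b :* d) := c :* a :+ :- (d :* b)) ≡.refl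
          (seq (re z) n) (seq (im z) n) (seq (re w) n) (seq (im w) n))
        (λ n → solve 4 (λ a b c d → a :* d :+ b :* c := c :* b :+ d :* a) ≡.refl
          (seq (re z) n) (seq (im z) n) (seq (re w) n) (seq (im w) n))
    }
    where
    pointwiseᶜ : ∀ z w → (∀ n → seq (re z) n ≡ seq (re w) n) →
      (∀ n → seq (im z) n ≡ seq (im w) n) → z ≈ᶜ w
    pointwiseᶜ z w re≡ im≡ = pointwise {re z} {re w} re≡ , pointwise {im z} {im w} im≡

  commutativeRing : CommutativeRing 0ℓ 0ℓ
  commutativeRing = record { isCommutativeRing = isCommutativeRing }

  -- Stability, cancellation and characteristic of the complex numbers

  ≈0-stable : ∀ {z} → ¬ ¬ z ≈ᶜ 0ᶜ → z ≈ᶜ 0ᶜ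
  ≈0-stable {z} ¬¬z≈0 =
    stable (re z) (λ re≉0 → ¬¬z≈0 (re≉0 ∘ proj₁)) ,
    stable (im z) (λ im≉0 → ¬¬z≈0 (im≉0 ∘ proj₂))
    where
    stable : ∀ x → ¬ ¬ x ≈ʳ 0ʳ → x ≈ʳ 0ʳ
    -- `x ≈ʳ 0ʳ` says that the sequence of x - 0 is null, so the Cauchy property of that difference
    -- is needed.
    stable x = null-stable (cauchy (x +ʳ -ʳ 0ʳ))

  -- z w = 0 implies |z|² w = z̄ z w = 0, which reduces the claim to cancellation in ℝ.
  *-cancel : ∀ {z w} → ¬ z ≈ᶜ 0ᶜ → z *ᶜ w ≈ᶜ 0ᶜ → w ≈ᶜ 0ᶜ
  *-cancel {z} {w} z≉0 (re-zw≈0 , im-zw≈0) =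
    null⇒≈0 {re w} (null-cancel (cauchy ∣z∣²) (cauchy (re w)) ∣z∣²-nonnull (null-cong
      (λ n → solve 4 (λ a b c d →
        a :* (a :* c :+ :- (b :* d)) :+ b :* (a :* d :+ b :* c) := (a :* a :+ b :* b) :* c) ≡.refl
        (seq (re z) n) (seq (im z) n) (seq (re w) n) (seq (im w) n))
      (null-+ (null-*ˡ (re z) re-null) (null-*ˡ (im z) im-null)))) ,
    null⇒≈0 {im w} (null-cancel (cauchy ∣z∣²) (cauchy (im w)) ∣z∣²-nonnull (null-cong
      (λ n → solve 4 (λ a b c d →
        a :* (a :* d :+ b :* c) :+ (:- b) :* (a :* c :+ :- (b :* d)) := (a :* a :+ b :* b) :* d) ≡.refl
        (seq (re z) n) (seq (im z) n) (seq (re w) n) (seq (im w) n))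
      (null-+ (null-*ˡ (re z) im-null) (null-*ˡ (-ʳ im z) re-null))))
    where
    ∣z∣² : ℝ
    ∣z∣² = re z *ʳ re z +ʳ im z *ʳ im z

    re-null : Null (seq (re (z *ᶜ w)))
    re-null = ≈0⇒null {re (z *ᶜ w)} re-zw≈0

    im-null : Null (seq (im (z *ᶜ w)))
    im-null = ≈0⇒null {im (z *ᶜ w)} im-zw≈0

    ∣z∣²-nonnull : ¬ Null (seq ∣z∣²)
    ∣z∣²-nonnull null = z≉0
      ( null⇒≈0 {re z} (null-sum-of-squares {t = seq (im z)} null)
      , null⇒≈0 {im z} (null-sum-of-squares {t = seq (re z)} (null-cong
          (λ n → ℚ.+-comm (seq (re z) n * seq (re z) n) (seq (im z) n * seq (im z) n)) null)))

  open import Algebra.Definitions.RawMonoid (RawRing.+-rawMonoid ℂ-rawRing)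
    using () renaming (_×_ to _×ᶜ_)

  -- Every term of the real part is 1 plus a nonnegative rational, hence the real part is bounded
  -- away from zero by 1.
  characteristic-0 : ∀ n → ¬ suc n ×ᶜ 1ᶜ ≈ᶜ 0ᶜ
  characteristic-0 n (re≈0 , _) = null⇒¬boundedAway (≈0⇒null {re (suc n ×ᶜ 1ᶜ)} re≈0)
    (1ℚ , ℚ.positive⁻¹ 1ℚ , 0 , λ m _ → begin
      1ℚ                              ≤⟨ ℚ.+-monoʳ-≤ 1ℚ (0≤n×1 n m) ⟩
      1ℚ + seq (re (n ×ᶜ 1ᶜ)) m       ≡⟨ ≡.sym (ℚ.0≤p⇒∣p∣≡p (0≤n×1 (suc n) m)) ⟩
      ∣ seq (re (suc n ×ᶜ 1ᶜ)) m ∣    ∎)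
    where
    open ℚ.≤-Reasoning
    0≤n×1 : ∀ n m → 0ℚ ℚ.≤ seq (re (n ×ᶜ 1ᶜ)) m
    0≤n×1 zero    m = ℚ.≤-refl
    0≤n×1 (suc n) m = ℚ.+-mono-≤ (ℚ.<⇒≤ (ℚ.positive⁻¹ 1ℚ)) (0≤n×1 n m)

open import Data.Nat.Base using (_*_)

theorem2 : ∃ λ (C : ℕ) → ∀ (n k : ℕ) (e : Fin k → Matrix n) →
    Anticommuting e → (∀ i → ¬ (e i *ᴹ e i ≈ᴹ 0ᴹ)) → k ≤ C * n
theorem2 = 2 , λ n k e anti square≉0 →
  -- `2 * n` computes to n + (n + 0), so only the trailing zero has to be introduced.
  subst (λ m → k ≤ n ℕ.+ m) (≡.sym (ℕ.+-identityʳ n))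
    (LinearAlgebra.anticommuting⇒≤ commutativeRing
      (λ {z} → ≈0-stable {z}) (λ {z} {w} → *-cancel {z} {w}) characteristic-0 e anti square≉0)
  where open ComplexNumbers
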